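{- For every integer $p\ge2$, every $\delta>0$ and every $r\in\mathbb N$, $r\ge1$, there exists $N=N(p,\delta,r)\in\mathbb N$ such that for every $n\ge N$ and every coloring of $\mathcal S_{\delta,p}(n)$ with $r$ colors, there are $A_0,\dots,A_p\in\mathcal S_{\delta,p}(n)$, all of the same color, with $A_0\cup\dots\cup A_p=n$.
   Context: Here $n=\{0,1,\dots,n-1\}$. For a finite set $X$, $p\in\mathbb N$ and $\delta>0$, $\mathcal S_{\delta,p}(X)=\{Y\subseteq X:\frac{\#X}{p}(1-\delta)\le\#Y\le\frac{\#X}{p}(1+\delta)\}$. -}

module Defs where

open import Data.Nat using (ℕ; NonZero)
open import Data.Integer using (+_)
open import Data.Rational using (ℚ; _/_; _*_; _-_; _+_; _≤_; 1ℚ)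
open import Data.Fin.Subset using (Subset; ∣_∣)
open import Data.Product using (_×_)

-- Y ∈ 𝒮_{δ,p}(n) :  (n/p)(1-δ) ≤ #Y ≤ (n/p)(1+δ),
-- where n = {0,…,n-1} is represented by Fin n and Y ⊆ n by Subset n.
InS : (δ : ℚ) (p : ℕ) .{{_ : NonZero p}} (n : ℕ) → Subset n → Set
InS δ p n Y =
  ((+ n / p) * (1ℚ - δ) ≤ (+ ∣ Y ∣ / 1)) ×
  ((+ ∣ Y ∣ / 1) ≤ (+ n / p) * (1ℚ + δ))

{-# OPTIONS --safe #-}

-- Probabilistic method. Let Y contain each point independently with probability
-- 1/p. If no colour class covers, then for each colour j the parts of a random
-- partition into p pieces cannot all lie below sets of colour j, so by the union
-- bound Y lies below no set of colour j with probability at least 1/p. These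
-- events are increasing in Y, so by Harris's inequality they hold for all r
-- colours at once with probability at least p^(-r). Then Y is not in 𝒮, which
-- for large n contradicts Chebyshev's inequality.
module Submission where

open import Defs
open import Data.Nat using (ℕ; NonZero; _≤_)
open import Data.Rational using (ℚ; 0ℚ; _<_)
open import Data.Fin using (Fin)
open import Data.Fin.Subset using (Subset; ⋃; ⊤)
open import Data.List using (tabulate)
open import Data.Product using (Σ; ∃; _×_; _,_)
open import Relation.Binary.PropositionalEquality using (_≡_)

open import Data.Bool using (Bool; true; false; if_then_else_)
open import Data.Fin using (zero; suc; _≟_)
open import Data.Fin.Properties using (any?)
open import Data.Fin.Subset using (inside; outside; ∣_∣; _⊆_; _∈_)
open import Data.Fin.Subset.Properties
  using (s⊆s; out⊆; ⊆⊤; ⊆-refl; ⊆-trans; ⊆-antisym; p⊆p∪q; q⊆p∪q; anySubset?; _⊆?_)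
import Data.Integer as ℤ
import Data.Integer.Properties as ℤ
import Data.Integer.Tactic.RingSolver as ℤSolver
open import Data.Maybe using (Maybe; just; nothing; maybe′)
open import Data.Maybe.Properties using (just-injective)
import Data.Maybe.Properties as Maybe
import Data.Nat as ℕ
open import Data.Nat using (_+_; _*_; _^_; _<?_; ∣_-_∣; z≤n)
open import Data.Nat.Properties hiding (_≟_)
open import Data.Nat.Tactic.RingSolver using (solve-∀)
open import Data.Product using (proj₁; proj₂)
import Data.Rational as ℚ
import Data.Rational.Properties as ℚ
import Data.Rational.Unnormalised as ℚᵘ
import Data.Rational.Unnormalised.Properties as ℚᵘ
open import Data.Sum using (inj₁; inj₂)
open import Data.Vec using (Vec; []; _∷_; map; lookup)
open import Data.Vec.Functional using (Vector)
open import Data.Vec.Properties using (lookup⇒[]=; lookup-map)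
open import Function using (_∘_)
open import Relation.Binary.PropositionalEquality
  using (refl; sym; trans; cong; cong₂; subst; module ≡-Reasoning)
open import Relation.Nullary using (Dec; yes; no; does; contradiction; _×-dec_)
open import Relation.Nullary.Decidable using (dec-true)
open import Algebra.Properties.Semiring.Sum +-*-semiring
  using (sum; ∑-comm; sum-cong-≗)
open import Algebra.Properties.CommutativeMonoid.Sum *-1-commutativeMonoid
  using () renaming (sum to product)

-- Finite sums.

pigeonhole-sum : ∀ {k} (g : Vector ℕ k) {m} → sum g ℕ.< k * m → ∃ λ a → g a ℕ.< m
pigeonhole-sum {ℕ.suc k} g {m} lt with g zero <? m | sum (g ∘ suc) <? k * m
... | yes h | _     = zero , h
... | no _  | yes h = let a , ga<m = pigeonhole-sum (g ∘ suc) h in suc a , ga<m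
... | no h₁ | no h₂ = contradiction (+-mono-≤ (≮⇒≥ h₁) (≮⇒≥ h₂)) (<⇒≱ lt)

sum<1⇒0 : ∀ {k} (g : Vector ℕ k) → sum g ℕ.< 1 → ∀ i → g i ≡ 0
sum<1⇒0 g lt zero    = m+n≡0⇒m≡0 (g zero) (n<1⇒n≡0 lt)
sum<1⇒0 g lt (suc i) = sum<1⇒0 (g ∘ suc) (≤-<-trans (m≤n+m _ (g zero)) lt) i

sum-const : ∀ k c → sum {k} (λ _ → c) ≡ k * c
sum-const ℕ.zero    c = refl
sum-const (ℕ.suc k) c = cong (c +_) (sum-const k c)

-- Exactly one of the `1 + q` letters equals `i`. The resulting weights, 1 for a match and `q` for a
-- mismatch, are those of the biased measure behind `E`.
sum-≟ : ∀ {q} (h : Bool → ℕ) (i : Fin (ℕ.suc q)) →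
        sum (λ a → h (does (i ≟ a))) ≡ h true + q * h false
sum-≟ {q} h zero = cong (h true +_) (sum-const q (h false))
sum-≟ {ℕ.suc q} h (suc i) = trans (cong (h false +_) (sum-≟ h i)) (swap (h false) (h true) (q * h false))
  where
  swap : ∀ a b c → a + (b + c) ≡ b + (a + c)
  swap = solve-∀

-- Scaled expectation, mean and variance.

-- (1 + q)^n times the expectation of f on a random subset that contains each
-- point independently with probability 1 / (1 + q).
E : ∀ (q : ℕ) {n} → (Subset n → ℕ) → ℕ
E q {ℕ.zero}  f = f []
E q {ℕ.suc n} f = E q (f ∘ (inside ∷_)) + q * E q (f ∘ (outside ∷_))

module _ {q : ℕ} where

  private
    p = ℕ.suc q

  E-cong : ∀ {n} {f g : Subset n → ℕ} → (∀ Y → f Y ≡ g Y) → E q f ≡ E q g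
  E-cong {ℕ.zero}  f≡g = f≡g []
  E-cong {ℕ.suc n} f≡g =
    cong₂ (λ a b → a + q * b) (E-cong (f≡g ∘ (inside ∷_))) (E-cong (f≡g ∘ (outside ∷_)))

  E-mono : ∀ {n} {f g : Subset n → ℕ} → (∀ Y → f Y ≤ g Y) → E q f ≤ E q g
  E-mono {ℕ.zero}  f≤g = f≤g []
  E-mono {ℕ.suc n} f≤g =
    +-mono-≤ (E-mono (f≤g ∘ (inside ∷_))) (*-monoʳ-≤ q (E-mono (f≤g ∘ (outside ∷_))))

  E-+ : ∀ {n} (f g : Subset n → ℕ) → E q (λ Y → f Y + g Y) ≡ E q f + E q g
  E-+ {ℕ.zero}  f g = refl
  E-+ {ℕ.suc n} f g = trans
    (cong₂ (λ a b → a + q * b) (E-+ (f ∘ (inside ∷_)) _) (E-+ (f ∘ (outside ∷_)) _))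
    (rearrange q (E q (f ∘ (inside ∷_))) _ _ _)
    where
    rearrange : ∀ q a b c d → (a + b) + q * (c + d) ≡ (a + q * c) + (b + q * d)
    rearrange = solve-∀

  E-*ˡ : ∀ {n} c (f : Subset n → ℕ) → E q (λ Y → c * f Y) ≡ c * E q f
  E-*ˡ {ℕ.zero}  c f = refl
  E-*ˡ {ℕ.suc n} c f = trans
    (cong₂ (λ a b → a + q * b) (E-*ˡ c (f ∘ (inside ∷_))) (E-*ˡ c (f ∘ (outside ∷_))))
    (rearrange q c (E q (f ∘ (inside ∷_))) _)
    where
    rearrange : ∀ q c a b → c * a + q * (c * b) ≡ c * (a + q * b)
    rearrange = solve-∀

  E-const : ∀ n c → E q {n} (λ _ → c) ≡ p ^ n * c
  E-const ℕ.zero    c = sym (+-identityʳ c)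
  E-const (ℕ.suc n) c = trans (cong (λ a → a + q * a) (E-const n c)) (sym (*-assoc p (p ^ n) c))

  -- The shift s makes the induction on n go through.
  E-mean : ∀ n s → E q {n} (λ Y → s + p * ∣ Y ∣) ≡ p ^ n * (s + n)
  E-mean ℕ.zero s = base q s
    where
    base : ∀ q s → s + ℕ.suc q * 0 ≡ 1 * (s + 0)
    base = solve-∀
  E-mean (ℕ.suc n) s = trans
    (cong₂ (λ a b → a + q * b)
      (trans (E-cong {n} λ Y → shift q s ∣ Y ∣) (E-mean n (s + p)))
      (E-mean n s))
    (step q (p ^ n) s n)
    where
    shift : ∀ q s k → s + ℕ.suc q * (1 + k) ≡ s + ℕ.suc q + ℕ.suc q * k
    shift = solve-∀
    step : ∀ q P s n → P * (s + ℕ.suc q + n) + q * (P * (s + n)) ≡ ℕ.suc q * P * (s + (1 + n))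
    step = solve-∀

  -- Second moment as squared mean plus variance: each point adds `p` with probability 1/p, so it
  -- contributes p² · (1/p) · (q/p) = q to the variance.
  E-square : ∀ n s → E q {n} (λ Y → (s + p * ∣ Y ∣) * (s + p * ∣ Y ∣)) ≡
                     p ^ n * ((s + n) * (s + n) + n * q)
  E-square ℕ.zero s = base q s
    where
    base : ∀ q s → (s + ℕ.suc q * 0) * (s + ℕ.suc q * 0) ≡ 1 * ((s + 0) * (s + 0) + 0 * q)
    base = solve-∀
  E-square (ℕ.suc n) s = trans
    (cong₂ (λ a b → a + q * b)
      (trans (E-cong {n} λ Y → shift q s ∣ Y ∣) (E-square n (s + p)))
      (E-square n s))
    (step q (p ^ n) s n)
    where
    shift : ∀ q s k → (s + ℕ.suc q * (1 + k)) * (s + ℕ.suc q * (1 + k)) ≡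
                      (s + ℕ.suc q + ℕ.suc q * k) * (s + ℕ.suc q + ℕ.suc q * k)
    shift = solve-∀
    step : ∀ q P s n →
           P * ((s + ℕ.suc q + n) * (s + ℕ.suc q + n) + n * q) + q * (P * ((s + n) * (s + n) + n * q)) ≡
           ℕ.suc q * P * ((s + (1 + n)) * (s + (1 + n)) + (1 + n) * q)
    step = solve-∀

  private
    -- The square of a difference, with the cross term kept on the left so that everything stays in
    -- ℕ.
    ∣-∣-square : ∀ a b → ∣ a - b ∣ * ∣ a - b ∣ + 2 * b * a ≡ a * a + b * b
    ∣-∣-square a b with ≤-total a b
    ... | inj₁ a≤b with k , refl ← m≤n⇒∃[o]m+o≡n a≤b rewrite ∣m-m+n∣≡n a k = expand a k
      where
      expand : ∀ a k → k * k + 2 * (a + k) * a ≡ a * a + (a + k) * (a + k)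
      expand = solve-∀
    ... | inj₂ b≤a with k , refl ← m≤n⇒∃[o]m+o≡n b≤a rewrite ∣-∣-comm (b + k) b | ∣m-m+n∣≡n b k = expand b k
      where
      expand : ∀ b k → k * k + 2 * b * (b + k) ≡ (b + k) * (b + k) + b * b
      expand = solve-∀

  -- Adding the cross term `2 * n * (p * ∣ Y ∣)` to both sides avoids subtraction. Its expectation
  -- comes from `E-mean`, the rest from `E-square`, and then it cancels.
  E-variance : ∀ n → E q {n} (λ Y → ∣ p * ∣ Y ∣ - n ∣ * ∣ p * ∣ Y ∣ - n ∣) ≡ p ^ n * (n * q)
  E-variance n = +-cancelʳ-≡ (2 * n * (p ^ n * n)) _ _ (begin
    E q d² + 2 * n * (p ^ n * n)                    ≡⟨ cong (λ m → E q d² + 2 * n * m) (E-mean n 0) ⟨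
    E q d² + 2 * n * E q {n} (λ Y → p * ∣ Y ∣)      ≡⟨ cong (E q d² +_) (E-*ˡ {n} (2 * n) _) ⟨
    E q d² + E q {n} (λ Y → 2 * n * (p * ∣ Y ∣))    ≡⟨ E-+ d² _ ⟨
    E q (λ Y → d² Y + 2 * n * (p * ∣ Y ∣))          ≡⟨ E-cong {n} (λ Y → ∣-∣-square (p * ∣ Y ∣) n) ⟩
    E q {n} (λ Y → p * ∣ Y ∣ * (p * ∣ Y ∣) + n * n) ≡⟨ E-+ {n} _ _ ⟩
    E q {n} (λ Y → p * ∣ Y ∣ * (p * ∣ Y ∣)) + E q {n} (λ _ → n * n)
                                                    ≡⟨ cong₂ _+_ (E-square n 0) (E-const n (n * n)) ⟩
    p ^ n * (n * n + n * q) + p ^ n * (n * n)       ≡⟨ collect (p ^ n) n q ⟩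
    p ^ n * (n * q) + 2 * n * (p ^ n * n)           ∎)
    where
    open ≡-Reasoning
    d² : Subset n → ℕ
    d² Y = ∣ p * ∣ Y ∣ - n ∣ * ∣ p * ∣ Y ∣ - n ∣
    collect : ∀ P n q → P * (n * n + n * q) + P * (n * n) ≡ P * (n * q) + 2 * n * (P * n)
    collect = solve-∀

-- Increasing functions and Harris's inequality.

Increasing : ∀ {n} → (Subset n → ℕ) → Set
Increasing f = ∀ {Y Z} → Y ⊆ Z → f Y ≤ f Z

private
  -- The case of a single point: the right side exceeds the left by exactly `q` times (f₁ - f₀)(g₁ -
  -- g₀).
  chebyshev-sum : ∀ q {f₀ f₁ g₀ g₁} → f₀ ≤ f₁ → g₀ ≤ g₁ →
                  (f₁ + q * f₀) * (g₁ + q * g₀) ≤ ℕ.suc q * (f₁ * g₁ + q * (f₀ * g₀))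
  chebyshev-sum q {f₀} {_} {g₀} f₀≤f₁ g₀≤g₁
    with a , refl ← m≤n⇒∃[o]m+o≡n f₀≤f₁ | b , refl ← m≤n⇒∃[o]m+o≡n g₀≤g₁ =
    ≤-trans (m≤m+n _ (q * (a * b))) (≤-reflexive (expand q f₀ g₀ a b))
    where
    expand : ∀ q f g a b →
             (f + a + q * f) * (g + b + q * g) + q * (a * b) ≡
             ℕ.suc q * ((f + a) * (g + b) + q * (f * g))
    expand = solve-∀

-- Induction on `n`: the one-point inequality handles the expectations conditioned on the first
-- point, which are ordered by monotonicity. The induction hypothesis then applies inside each of
-- the two branches.
harris : ∀ q {n} {f g : Subset n → ℕ} → Increasing f → Increasing g →
         E q f * E q g ≤ ℕ.suc q ^ n * E q (λ Y → f Y * g Y)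
harris q {ℕ.zero} {f} {g} f↑ g↑ = ≤-reflexive (sym (*-identityˡ (f [] * g [])))
harris q {ℕ.suc n} {f} {g} f↑ g↑ = begin
  (E q f₁ + q * E q f₀) * (E q g₁ + q * E q g₀)
    ≤⟨ chebyshev-sum q (E-mono {q} {n} {f₀} {f₁} λ _ → f↑ (out⊆ ⊆-refl))
                       (E-mono {q} {n} {g₀} {g₁} λ _ → g↑ (out⊆ ⊆-refl)) ⟩
  p * (E q f₁ * E q g₁ + q * (E q f₀ * E q g₀))
    ≤⟨ *-monoʳ-≤ p (+-mono-≤ (harris q (f↑ ∘ s⊆s) (g↑ ∘ s⊆s))
                             (*-monoʳ-≤ q (harris q (f↑ ∘ s⊆s) (g↑ ∘ s⊆s)))) ⟩
  p * (p ^ n * E q (λ Y → f₁ Y * g₁ Y) + q * (p ^ n * E q (λ Y → f₀ Y * g₀ Y)))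
    ≡⟨ collect q (p ^ n) (E q (λ Y → f₁ Y * g₁ Y)) (E q (λ Y → f₀ Y * g₀ Y)) ⟩
  p * p ^ n * (E q (λ Y → f₁ Y * g₁ Y) + q * E q (λ Y → f₀ Y * g₀ Y)) ∎
  where
  open ≤-Reasoning
  p = ℕ.suc q
  f₁ f₀ g₁ g₀ : Subset n → ℕ
  f₁ = f ∘ (inside ∷_)
  f₀ = f ∘ (outside ∷_)
  g₁ = g ∘ (inside ∷_)
  g₀ = g ∘ (outside ∷_)
  collect : ∀ q P x y → ℕ.suc q * (P * x + q * (P * y)) ≡ ℕ.suc q * P * (x + q * y)
  collect = solve-∀

product-mono : ∀ {r} {f g : Vector ℕ r} → (∀ j → f j ≤ g j) → product f ≤ product g
product-mono {ℕ.zero}  f≤g = ≤-refl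
product-mono {ℕ.suc r} f≤g = *-mono-≤ (f≤g zero) (product-mono (f≤g ∘ suc))

product≡0 : ∀ {r} {f : Vector ℕ r} j → f j ≡ 0 → product f ≡ 0
product≡0 {f = f} zero    fj≡0 = cong (_* product (f ∘ suc)) fj≡0
product≡0 {f = f} (suc j) fj≡0 = trans (cong (f zero *_) (product≡0 j fj≡0)) (*-zeroʳ (f zero))

product≤1 : ∀ {r} {f : Vector ℕ r} → (∀ j → f j ≤ 1) → product f ≤ 1
product≤1 {ℕ.zero}  f≤1 = ≤-refl
product≤1 {ℕ.suc r} f≤1 = *-mono-≤ (f≤1 zero) (product≤1 (f≤1 ∘ suc))

-- In probabilities: if each of `r` increasing functions has expectation at least 1/p, their product
-- has expectation at least p^(-r).
harris-product : ∀ q {n r} (f : Fin r → Subset n → ℕ) → (∀ j → Increasing (f j)) →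
                 (∀ j → ℕ.suc q ^ n ≤ ℕ.suc q * E q (f j)) →
                 ℕ.suc q ^ n ≤ ℕ.suc q ^ r * E q (λ Y → product (λ j → f j Y))
harris-product q {n} {ℕ.zero} f f↑ large = ≤-reflexive (begin
  p ^ n               ≡⟨ *-identityʳ (p ^ n) ⟨
  p ^ n * 1           ≡⟨ E-const n 1 ⟨
  E q {n} (λ _ → 1)     ≡⟨ *-identityˡ _ ⟨
  1 * E q {n} (λ _ → 1) ∎)
  where
  open ≡-Reasoning
  p = ℕ.suc q
-- Multiplying two scaled bounds doubles the normalising factor `p ^ n`; `harris` leaves one copy on
-- the right, and that copy cancels.
harris-product q {n} {ℕ.suc r} f f↑ large = *-cancelˡ-≤ (p ^ n) {{m^n≢0 p n}} (begin
  p ^ n * p ^ n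
    ≤⟨ *-mono-≤ (large zero) (harris-product q (f ∘ suc) (f↑ ∘ suc) (large ∘ suc)) ⟩
  p * E q (f zero) * (p ^ r * E q F)
    ≡⟨ rearrange p (E q (f zero)) (p ^ r) (E q F) ⟩
  p ^ ℕ.suc r * (E q (f zero) * E q F)
    ≤⟨ *-monoʳ-≤ (p ^ ℕ.suc r) (harris q (f↑ zero) λ Y⊆Z → product-mono λ j → f↑ (suc j) Y⊆Z) ⟩
  p ^ ℕ.suc r * (p ^ n * E q (λ Y → f zero Y * F Y))
    ≡⟨ swap (p ^ ℕ.suc r) (p ^ n) _ ⟩
  p ^ n * (p ^ ℕ.suc r * E q (λ Y → f zero Y * F Y)) ∎)
  where
  open ≤-Reasoning
  p = ℕ.suc q
  F : Subset n → ℕ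
  F Y = product (λ j → f (suc j) Y)
  rearrange : ∀ p x R y → p * x * (R * y) ≡ p * R * (x * y)
  rearrange = solve-∀
  swap : ∀ a b c → a * (b * c) ≡ b * (a * c)
  swap = solve-∀

-- Random partitions and the union bound.

part : ∀ {k n} → Vec (Fin k) n → Fin k → Subset n
part w i = map (λ a → does (i ≟ a)) w

∈-part : ∀ {k n} (w : Vec (Fin k) n) x → x ∈ part w (lookup w x)
∈-part w x = lookup⇒[]= x _
  (trans (lookup-map x _ w) (dec-true (lookup w x ≟ lookup w x) refl))

-- The parts of a uniformly random word all have the distribution behind E, so
-- this is the union bound.
union-bound : ∀ q {n} (f : Fin (ℕ.suc q) → Subset n → ℕ) →
              sum (λ i → E q (f i)) ℕ.< ℕ.suc q ^ n → ∃ λ w → ∀ i → f i (part w i) ≡ 0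
union-bound q {ℕ.zero}  f lt = [] , sum<1⇒0 _ lt
union-bound q {ℕ.suc n} f lt =
  -- Method of conditional expectations: summed over all first letters, the conditional totals stay
  -- below `p * p ^ n`, so some letter keeps its own total below `p ^ n`.
  let a , lt′ = pigeonhole-sum (λ a → sum (λ i → E q (tail a i)))
                  (subst (ℕ._< ℕ.suc q * ℕ.suc q ^ n) by-first-letter lt)
      w , f≡0 = union-bound q (tail a) lt′
  in a ∷ w , f≡0
  where
  tail : Fin (ℕ.suc q) → Fin (ℕ.suc q) → Subset n → ℕ
  tail a i = f i ∘ (does (i ≟ a) ∷_)
  by-first-letter : sum (λ i → E q (f i)) ≡ sum (λ a → sum (λ i → E q (tail a i)))
  by-first-letter = trans
    (sum-cong-≗ λ i → sym (sum-≟ (λ b → E q (f i ∘ (b ∷_))) i))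
    (∑-comm λ i a → E q (tail a i))

-- Indicators and partial colourings.

𝟙¬ : ∀ {P : Set} → Dec P → ℕ
𝟙¬ P? = if does P? then 0 else 1

𝟙¬≡0⁺ : ∀ {P} (P? : Dec P) → P → 𝟙¬ P? ≡ 0
𝟙¬≡0⁺ (yes _) _ = refl
𝟙¬≡0⁺ (no ¬P) P = contradiction P ¬P

𝟙¬≡0⁻ : ∀ {P} (P? : Dec P) → 𝟙¬ P? ≡ 0 → P
𝟙¬≡0⁻ (yes P) _ = P

𝟙¬-mono : ∀ {P Q} (P? : Dec P) (Q? : Dec Q) → (Q → P) → 𝟙¬ P? ≤ 𝟙¬ Q?
𝟙¬-mono (yes _) _       _   = z≤n
𝟙¬-mono (no ¬P) (yes Q) Q⇒P = contradiction (Q⇒P Q) ¬P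
𝟙¬-mono (no _)  (no _)  _   = ≤-refl

𝟙¬≤1 : ∀ {P} (P? : Dec P) → 𝟙¬ P? ≤ 1
𝟙¬≤1 (yes _) = z≤n
𝟙¬≤1 (no _)  = ≤-refl

uncoloured : ∀ {n r} → (Subset n → Maybe (Fin r)) → Subset n → ℕ
uncoloured colour Y = maybe′ (λ _ → 0) 1 (colour Y)

module _ {n r} (colour : Subset n → Maybe (Fin r)) where

  Below : Fin r → Subset n → Set
  Below j Y = ∃ λ Z → Y ⊆ Z × colour Z ≡ just j

  below? : ∀ j Y → Dec (Below j Y)
  below? j Y = anySubset? λ Z → (Y ⊆? Z) ×-dec Maybe.≡-dec _≟_ (colour Z) (just j)

  𝟙¬below : Fin r → Subset n → ℕ
  𝟙¬below j Y = 𝟙¬ (below? j Y)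

  -- A set of colour `j` above `Z` is also above each subset of `Z`, so lying below no such set
  -- passes to supersets.
  𝟙¬below-increasing : ∀ j → Increasing (𝟙¬below j)
  𝟙¬below-increasing j {Y} {Z} Y⊆Z = 𝟙¬-mono (below? j Y) (below? j Z)
    λ (W , Z⊆W , eq) → W , ⊆-trans Y⊆Z Z⊆W , eq

  -- A coloured `Y` lies below itself in its own colour, which kills one factor. Only uncoloured
  -- sets can therefore avoid all colours.
  product≤uncoloured : ∀ Y → product (λ j → 𝟙¬below j Y) ≤ uncoloured colour Y
  product≤uncoloured Y with colour Y in eq
  ... | just j  = ≤-reflexive (product≡0 j (𝟙¬≡0⁺ (below? j Y) (Y , ⊆-refl , eq)))
  ... | nothing = product≤1 λ j → 𝟙¬≤1 (below? j Y)

  monochromatic-cover :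
    ∀ q → ℕ.suc q ^ r * E q (uncoloured colour) ℕ.< ℕ.suc q ^ n →
    ∃ λ j → Σ (Fin (ℕ.suc q) → Subset n) λ A →
      (∀ i → colour (A i) ≡ just j) × (∀ x → ∃ λ i → x ∈ A i)
  monochromatic-cover q few with any? (λ j → ℕ.suc q * E q (𝟙¬below j) <? ℕ.suc q ^ n)
  -- All `p` parts use the same function, so the union bound needs only `p` times one expectation.
  -- Enlarging each part to a set of colour `j` keeps every point covered.
  ... | yes (j , lt) =
    let w , w≡0 = union-bound q (λ _ → 𝟙¬below j)
                    (subst (ℕ._< ℕ.suc q ^ n) (sym (sum-const (ℕ.suc q) _)) lt)
        below i = 𝟙¬≡0⁻ (below? j (part w i)) (w≡0 i)
    in j , (λ i → proj₁ (below i)) , (λ i → proj₂ (proj₂ (below i)))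
       , λ x → lookup w x , proj₁ (proj₂ (below (lookup w x))) (∈-part w x)
  -- Every colour is now avoided with probability at least 1/p, so some sets must be uncoloured with
  -- total probability at least p^(-r), against `few`.
  ... | no ¬small = contradiction few (≤⇒≯ (≤-trans
    (harris-product q 𝟙¬below 𝟙¬below-increasing λ j → ≮⇒≥ λ lt → ¬small (j , lt))
    (*-monoʳ-≤ (ℕ.suc q ^ r) (E-mono {q} product≤uncoloured))))

-- Sets of nearly average size.

InS? : ∀ δ p .{{_ : NonZero p}} n (Y : Subset n) → Dec (InS δ p n Y)
InS? δ p n Y = (_ ℚ.≤? _) ×-dec (_ ℚ.≤? _)

⋃-tabulate≡⊤ : ∀ {k n} (A : Fin k → Subset n) → (∀ x → ∃ λ i → x ∈ A i) → ⋃ (tabulate A) ≡ ⊤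
⋃-tabulate≡⊤ A covers = ⊆-antisym ⊆⊤ λ {x} _ → let i , x∈Aᵢ = covers x in A⊆⋃ A i x∈Aᵢ
  where
  A⊆⋃ : ∀ {k n} (A : Fin k → Subset n) i → A i ⊆ ⋃ (tabulate A)
  A⊆⋃ A zero    = p⊆p∪q _
  A⊆⋃ A (suc i) = q⊆p∪q (A zero) _ ∘ A⊆⋃ (A ∘ suc) i

private module _ {p k n a b : ℕ} .{{_ : NonZero a}} (near : b * ∣ p * k - n ∣ ≤ n) where

  -- With δ = a/b, `near` bounds the deviation of `k` from n/p by 1/b of that mean, and 1/b is at
  -- most δ since `a` is nonzero. This is the lower bound cleared of denominators, with the negative
  -- term moved to the right.
  near-mean⇒lowerℕ : n * b ≤ k * (p * b) + n * a
  near-mean⇒lowerℕ = begin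
    n * b                           ≤⟨ *-monoˡ-≤ b (m≤n+∣n-m∣ n (p * k)) ⟩
    (p * k + ∣ p * k - n ∣) * b     ≡⟨ expand p k ∣ p * k - n ∣ b ⟩
    k * (p * b) + b * ∣ p * k - n ∣ ≤⟨ +-monoʳ-≤ (k * (p * b)) (≤-trans near (m≤m*n n a)) ⟩
    k * (p * b) + n * a             ∎
    where
    open ≤-Reasoning
    expand : ∀ p k d b → (p * k + d) * b ≡ k * (p * b) + b * d
    expand = solve-∀

  near-mean⇒upperℕ : k * (p * b) ≤ n * b + n * a
  near-mean⇒upperℕ = begin
    k * (p * b)               ≡⟨ assoc k p b ⟩
    p * k * b                 ≤⟨ *-monoˡ-≤ b (m≤n+∣m-n∣ (p * k) n) ⟩
    (n + ∣ p * k - n ∣) * b   ≡⟨ expand n ∣ p * k - n ∣ b ⟩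
    n * b + b * ∣ p * k - n ∣ ≤⟨ +-monoʳ-≤ (n * b) (≤-trans near (m≤m*n n a)) ⟩
    n * b + n * a             ∎
    where
    open ≤-Reasoning
    assoc : ∀ k p b → k * (p * b) ≡ p * k * b
    assoc = solve-∀
    expand : ∀ n d b → (n + d) * b ≡ n * b + b * d
    expand = solve-∀

  -- near-mean⇒lower and near-mean⇒upper are the cross-multiplied forms to which
  -- ≤ on unnormalised rationals unfolds for n/p · (1 ∓ a/b) and k.
  near-mean⇒lower : ℤ.+ n ℤ.* (ℤ.+ 1 ℤ.* ℤ.+ b ℤ.+ (ℤ.- ℤ.+ a) ℤ.* ℤ.+ 1) ℤ.* ℤ.+ 1 ℤ.≤
                    ℤ.+ k ℤ.* ℤ.+ (p * (1 * b))
  near-mean⇒lower = begin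
    ℤ.+ n ℤ.* (ℤ.+ 1 ℤ.* ℤ.+ b ℤ.+ (ℤ.- ℤ.+ a) ℤ.* ℤ.+ 1) ℤ.* ℤ.+ 1
      ≡⟨ expand (ℤ.+ n) (ℤ.+ b) (ℤ.+ a) ⟩
    ℤ.+ n ℤ.* ℤ.+ b ℤ.- ℤ.+ n ℤ.* ℤ.+ a
      ≡⟨ cong₂ ℤ._-_ (ℤ.pos-* n b) (ℤ.pos-* n a) ⟨
    ℤ.+ (n * b) ℤ.- ℤ.+ (n * a)
      ≤⟨ ℤ.+-monoˡ-≤ (ℤ.- ℤ.+ (n * a)) (ℤ.+≤+ near-mean⇒lowerℕ) ⟩
    ℤ.+ (k * (p * b) + n * a) ℤ.- ℤ.+ (n * a)
      ≡⟨ cong (ℤ._- ℤ.+ (n * a)) (ℤ.pos-+ (k * (p * b)) (n * a)) ⟩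
    ℤ.+ (k * (p * b)) ℤ.+ ℤ.+ (n * a) ℤ.- ℤ.+ (n * a)
      ≡⟨ cancel (ℤ.+ (k * (p * b))) (ℤ.+ (n * a)) ⟩
    ℤ.+ (k * (p * b))
      ≡⟨ ℤ.pos-* k (p * b) ⟩
    ℤ.+ k ℤ.* ℤ.+ (p * b)
      ≡⟨ cong (λ m → ℤ.+ k ℤ.* ℤ.+ (p * m)) (*-identityˡ b) ⟨
    ℤ.+ k ℤ.* ℤ.+ (p * (1 * b)) ∎
    where
    open ℤ.≤-Reasoning
    expand : ∀ n b a → n ℤ.* (ℤ.+ 1 ℤ.* b ℤ.+ (ℤ.- a) ℤ.* ℤ.+ 1) ℤ.* ℤ.+ 1 ≡
                       n ℤ.* b ℤ.- n ℤ.* a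
    expand = ℤSolver.solve-∀
    cancel : ∀ x y → x ℤ.+ y ℤ.- y ≡ x
    cancel = ℤSolver.solve-∀

  near-mean⇒upper : ℤ.+ k ℤ.* ℤ.+ (p * (1 * b)) ℤ.≤
                    ℤ.+ n ℤ.* (ℤ.+ 1 ℤ.* ℤ.+ b ℤ.+ ℤ.+ a ℤ.* ℤ.+ 1) ℤ.* ℤ.+ 1
  near-mean⇒upper = begin
    ℤ.+ k ℤ.* ℤ.+ (p * (1 * b))
      ≡⟨ cong (λ m → ℤ.+ k ℤ.* ℤ.+ (p * m)) (*-identityˡ b) ⟩
    ℤ.+ k ℤ.* ℤ.+ (p * b)
      ≡⟨ ℤ.pos-* k (p * b) ⟨
    ℤ.+ (k * (p * b))
      ≤⟨ ℤ.+≤+ near-mean⇒upperℕ ⟩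
    ℤ.+ (n * b + n * a)
      ≡⟨ ℤ.pos-+ (n * b) (n * a) ⟩
    ℤ.+ (n * b) ℤ.+ ℤ.+ (n * a)
      ≡⟨ cong₂ ℤ._+_ (ℤ.pos-* n b) (ℤ.pos-* n a) ⟩
    ℤ.+ n ℤ.* ℤ.+ b ℤ.+ ℤ.+ n ℤ.* ℤ.+ a
      ≡⟨ expand (ℤ.+ n) (ℤ.+ b) (ℤ.+ a) ⟩
    ℤ.+ n ℤ.* (ℤ.+ 1 ℤ.* ℤ.+ b ℤ.+ ℤ.+ a ℤ.* ℤ.+ 1) ℤ.* ℤ.+ 1 ∎
    where
    open ℤ.≤-Reasoning
    expand : ∀ n b a → n ℤ.* b ℤ.+ n ℤ.* a ≡
                       n ℤ.* (ℤ.+ 1 ℤ.* b ℤ.+ a ℤ.* ℤ.+ 1) ℤ.* ℤ.+ 1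
    expand = ℤSolver.solve-∀

-- The operations of ℚ reduce fractions. Passing to unnormalised rationals exposes plain numerators
-- and denominators, to which the integer inequalities apply.
near-mean⇒InS : ∀ δ → 0ℚ < δ → ∀ q n (Y : Subset n) →
  ℚ.↧ₙ δ * ∣ ℕ.suc q * ∣ Y ∣ - n ∣ ≤ n → InS δ (ℕ.suc q) n Y
near-mean⇒InS δ@(ℚ.mkℚ (ℤ.+ ℕ.zero) _ _) 0<δ q n Y near with () ← ℚ.positive 0<δ
near-mean⇒InS δ@(ℚ.mkℚ ℤ.-[1+ _ ] _ _) 0<δ q n Y near with () ← ℚ.positive 0<δ
near-mean⇒InS δ@(ℚ.mkℚ (ℤ.+ ℕ.suc a) b-1 _) 0<δ q n Y near =
  ℚ.toℚᵘ-cancel-≤ (begin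
    ℚ.toℚᵘ ((ℤ.+ n ℚ./ p) ℚ.* (ℚ.1ℚ ℚ.- δ)) ≃⟨ ℚ.toℚᵘ-homo-* (ℤ.+ n ℚ./ p) (ℚ.1ℚ ℚ.- δ) ⟩
    ℚ.toℚᵘ (ℤ.+ n ℚ./ p) ℚᵘ.* ℚ.toℚᵘ (ℚ.1ℚ ℚ.- δ)
      ≃⟨ ℚᵘ.*-cong (ℚ.toℚᵘ-fromℚᵘ (ℚᵘ.mkℚᵘ (ℤ.+ n) q)) (ℚ.toℚᵘ-homo-+ ℚ.1ℚ (ℚ.- δ)) ⟩
    ℚᵘ.mkℚᵘ (ℤ.+ n) q ℚᵘ.* (ℚᵘ.1ℚᵘ ℚᵘ.+ ℚ.toℚᵘ (ℚ.- δ)) ≤⟨ ℚᵘ.*≤* (near-mean⇒lower {p} {k} {n} {ℕ.suc a} near) ⟩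
    ℚᵘ.mkℚᵘ (ℤ.+ k) 0                   ≃⟨ ℚ.toℚᵘ-fromℚᵘ (ℚᵘ.mkℚᵘ (ℤ.+ k) 0) ⟨
    ℚ.toℚᵘ (ℤ.+ k ℚ./ 1) ∎) ,
  ℚ.toℚᵘ-cancel-≤ (begin
    ℚ.toℚᵘ (ℤ.+ k ℚ./ 1)                ≃⟨ ℚ.toℚᵘ-fromℚᵘ (ℚᵘ.mkℚᵘ (ℤ.+ k) 0) ⟩
    ℚᵘ.mkℚᵘ (ℤ.+ k) 0                   ≤⟨ ℚᵘ.*≤* (near-mean⇒upper {p} {k} {n} {ℕ.suc a} near) ⟩
    ℚᵘ.mkℚᵘ (ℤ.+ n) q ℚᵘ.* (ℚᵘ.1ℚᵘ ℚᵘ.+ ℚ.toℚᵘ δ)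
      ≃⟨ ℚᵘ.*-cong (ℚ.toℚᵘ-fromℚᵘ (ℚᵘ.mkℚᵘ (ℤ.+ n) q)) (ℚ.toℚᵘ-homo-+ ℚ.1ℚ δ) ⟨
    ℚ.toℚᵘ (ℤ.+ n ℚ./ p) ℚᵘ.* ℚ.toℚᵘ (ℚ.1ℚ ℚ.+ δ)
      ≃⟨ ℚ.toℚᵘ-homo-* (ℤ.+ n ℚ./ p) (ℚ.1ℚ ℚ.+ δ) ⟨
    ℚ.toℚᵘ ((ℤ.+ n ℚ./ p) ℚ.* (ℚ.1ℚ ℚ.+ δ)) ∎)
  where
  open ℚᵘ.≤-Reasoning
  p = ℕ.suc q
  k = ∣ Y ∣

-- Chebyshev's inequality and the conclusion.

-- Markov's inequality for the squared deviation d²: `bound` dominates `f` by b²d²/n², whose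
-- expectation is b²q/n, and `large` makes this less than 1/R.
chebyshev : ∀ q b R n (f : Subset n → ℕ) → b * b * q * R ℕ.< n →
  (∀ Y → n * n * f Y ≤ b * b * (∣ ℕ.suc q * ∣ Y ∣ - n ∣ * ∣ ℕ.suc q * ∣ Y ∣ - n ∣)) →
  R * E q f ℕ.< ℕ.suc q ^ n
chebyshev q b R n@(ℕ.suc _) f large bound = *-cancelˡ-< (n * n) _ _ (begin-strict
  n * n * (R * E q f)               ≡⟨ swap (n * n) R (E q f) ⟩
  R * (n * n * E q f)               ≡⟨ cong (R *_) (E-*ˡ (n * n) f) ⟨
  R * E q (λ Y → n * n * f Y)       ≤⟨ *-monoʳ-≤ R (E-mono {q} bound) ⟩
  R * E q (λ Y → b * b * d² Y)      ≡⟨ cong (R *_) (trans (E-*ˡ (b * b) d²) (cong (b * b *_) (E-variance n))) ⟩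
  R * (b * b * (P * (n * q)))       ≡⟨ rearrange R (b * b) P n q ⟩
  b * b * q * R * (n * P)           <⟨ *-monoˡ-< (n * P) {{m*n≢0 n P {{_}} {{m^n≢0 (ℕ.suc q) n}}}} large ⟩
  n * (n * P)                       ≡⟨ *-assoc n n P ⟨
  n * n * P                         ∎)
  where
  open ≤-Reasoning
  P = ℕ.suc q ^ n
  d² : Subset n → ℕ
  d² Y = ∣ ℕ.suc q * ∣ Y ∣ - n ∣ * ∣ ℕ.suc q * ∣ Y ∣ - n ∣
  swap : ∀ a b c → a * (b * c) ≡ b * (a * c)
  swap = solve-∀
  rearrange : ∀ R B P n q → R * (B * (P * (n * q))) ≡ B * q * R * (n * P)
  rearrange = solve-∀

theorem5p14 : (p : ℕ) .{{_ : NonZero p}} → 2 ≤ p →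
    (δ : ℚ) → 0ℚ < δ →
    (r : ℕ) → 1 ≤ r →
    ∃ λ (N : ℕ) → (n : ℕ) → N ≤ n →
    (c : (Y : Subset n) → InS δ p n Y → Fin r) →
    Σ (Fin (ℕ.suc p) → Subset n) λ A →
    Σ ((i : Fin (ℕ.suc p)) → InS δ p n (A i)) λ A∈S →
    ((i j : Fin (ℕ.suc p)) → c (A i) (A∈S i) ≡ c (A j) (A∈S j)) ×
    (⋃ (tabulate A) ≡ ⊤)
-- The threshold of `chebyshev` with `R = p ^ r`, the factor in `monochromatic-cover`. The successor
-- turns `N ≤ n` into the strict inequality required.
theorem5p14 (ℕ.suc q) _ δ 0<δ r _ = ℕ.suc (b * b * q * p ^ r) , proof
  where
  p = ℕ.suc q
  b = ℚ.↧ₙ δ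

  proof : (n : ℕ) → ℕ.suc (b * b * q * p ^ r) ≤ n →
    (c : (Y : Subset n) → InS δ p n Y → Fin r) →
    Σ (Fin (ℕ.suc p) → Subset n) λ A →
    Σ ((i : Fin (ℕ.suc p)) → InS δ p n (A i)) λ A∈S →
    ((i j : Fin (ℕ.suc p)) → c (A i) (A∈S i) ≡ c (A j) (A∈S j)) ×
    (⋃ (tabulate A) ≡ ⊤)
  proof n N≤n c =
    let j , A , A-colour , covers = monochromatic-cover colour q
                                      (chebyshev q b (p ^ r) n (uncoloured colour) N≤n far)
        in-S i = coloured (A-colour i)
    in A ∘ repeat₀ , (λ i → proj₁ (in-S (repeat₀ i)))
       , (λ i k → trans (proj₂ (in-S (repeat₀ i))) (sym (proj₂ (in-S (repeat₀ k)))))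
       , ⋃-tabulate≡⊤ (A ∘ repeat₀) (λ x → suc (proj₁ (covers x)) , proj₂ (covers x))
    where
    -- The cover consists of `p` sets, while the theorem asks for `p + 1`, so the first is listed
    -- twice.
    repeat₀ : Fin (ℕ.suc p) → Fin p
    repeat₀ zero    = zero
    repeat₀ (suc i) = i

    -- Extends `c` to all subsets, over which `E` averages; `nothing` marks the sets outside 𝒮.
    colour : Subset n → Maybe (Fin r)
    colour Y with InS? δ p n Y
    ... | yes Y∈S = just (c Y Y∈S)
    ... | no _    = nothing

    -- Returns the very membership proof that `colour` gave to `c`, so values of `c` at different
    -- proofs need no comparison.
    coloured : ∀ {Y j} → colour Y ≡ just j → Σ (InS δ p n Y) λ Y∈S → c Y Y∈S ≡ j
    coloured {Y} eq with yes Y∈S ← InS? δ p n Y = Y∈S , just-injective eq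

    far : ∀ Y → n * n * uncoloured colour Y ≤ b * b * (∣ p * ∣ Y ∣ - n ∣ * ∣ p * ∣ Y ∣ - n ∣)
    far Y with InS? δ p n Y
    ... | yes _  = ≤-trans (≤-reflexive (*-zeroʳ (n * n))) z≤n
    ... | no Y∉S = begin
      n * n * 1             ≡⟨ *-identityʳ (n * n) ⟩
      n * n                 ≤⟨ *-mono-≤ n≤bd n≤bd ⟩
      b * d * (b * d)       ≡⟨ rearrange b d ⟩
      b * b * (d * d)       ∎
      where
      open ≤-Reasoning
      d = ∣ p * ∣ Y ∣ - n ∣
      -- Contrapositive of `near-mean⇒InS`: a set outside 𝒮 deviates too far from the mean.
      n≤bd : n ≤ b * d
      n≤bd = ≰⇒≥ (Y∉S ∘ near-mean⇒InS δ 0<δ q n Y)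
      rearrange : ∀ b d → b * d * (b * d) ≡ b * b * (d * d)
      rearrange = solve-∀
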